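{- Let $a_{n,k}=|\mathcal{S}_{n,k}^{1\prec n}(1324)|$. For $n\ge3$ and $2\le k\le n-1$, \[ a_{n,k}=\sum_{m=2}^{n-k+1} a_{m,1}\,a_{n-m+1,k-1}. \] Consequently, for every $k\ge1$, $T_{1,k}(x)=x f(x)^k$, and $g_1(x,t)=\dfrac{x t f(x)}{1-t f(x)}$ as formal power series.
   Context: $\mathcal{S}_n(1324)$ denotes the set of permutations of $\{1,\dots,n\}$ (in one-line notation) avoiding the pattern $1324$. For $a,k\ge1$, $\mathcal{S}_{n,k}^{a\prec n}(1324)$ is the set of $\sigma\in\mathcal{S}_n(1324)$ with $\sigma^{ -1}(n)-\sigma^{ -1}(a)=k$ and $\sigma^{ -1}(b)>\sigma^{ -1}(n)$ for all $b\in\{1,\dots,a-1\}$. Define $T_{a,k}(x)=\sum_{n\ge k+1}|\mathcal{S}_{n,k}^{a\prec n}(1324)|x^n$ and $g_a(x,t)=\sum_{k\ge1}t^kT_{a,k}(x)$. Let $f(x)=\sum_{n\ge2}a_{n,1}x^{n-1}=x+2x^2+6x^3+22x^4+\cdots$ (so that $T_{1,1}(x)=xf(x)$; its coefficients are the OEIS sequence A000139). -}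

module Defs where

open import Level using (0ℓ)
open import Algebra.Bundles.Raw using (RawRing)
open import Algebra.Definitions.RawSemiring as RawSemiringDefs using ()
open import Data.Bool.Base using (if_then_else_)
open import Data.Fin.Base as Fin using (Fin; toℕ; punchIn)
open import Data.Fin.Permutation
  using (Permutation′; id; _⟨$⟩ʳ_; _⟨$⟩ˡ_; insert; remove; insert-punchIn; insert-remove)
  renaming (_≈_ to _≈ₚ_)
open import Data.Fin.Properties as Fin using (any?; all?; punchIn-injective)
open import Data.Integer.Base using (ℤ; +_; 0ℤ; +-*-rawRing)
open import Data.List.Base
  using (List; []; _∷_; map; filter; length; allFin; applyUpTo; cartesianProductWith)
open import Data.List.Membership.Propositional.Properties using (∈-allFin)
open import Data.List.Membership.Setoid.Properties using (∈-cartesianProductWith⁺; ∈-resp-≈)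
open import Data.List.Relation.Unary.All using ([])
open import Data.List.Relation.Unary.AllPairs using ([]; _∷_)
open import Data.List.Relation.Unary.Any using (here)
open import Data.List.Relation.Unary.Enumerates.Setoid using (IsEnumeration)
open import Data.List.Relation.Unary.Unique.Propositional.Properties using (allFin⁺)
open import Data.List.Relation.Unary.Unique.Setoid using (Unique)
import Data.List.Relation.Unary.Unique.Setoid.Properties as Unique
open import Data.Nat.Base as ℕ using (ℕ; zero; suc; _∸_)
open import Data.Nat.ListAction using (sum)
open import Data.Nat.Properties using (_≤?_; _≟_)
open import Data.Product.Base using (∃; ∃-syntax; _×_; _,_)
open import Relation.Binary.Bundles using (Setoid)
open import Relation.Binary.PropositionalEquality.Core using (_≡_; refl; sym; trans; cong)
open import Relation.Binary.PropositionalEquality.Properties as ≡ using ()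
open import Relation.Nullary.Decidable using (does; ¬?; _×-dec_; _→-dec_)
open import Relation.Nullary.Negation using (¬_)
open import Relation.Unary using (Pred; Decidable)

-- A permutation σ of {1,…,n} is a bijection of Fin n, with both positions
-- and values shifted down by one: the value v is the index i with suc (toℕ i) ≡ v.
-- σ ⟨$⟩ʳ i is the value at position i, σ ⟨$⟩ˡ v the position of the value v.

permutationSetoid : ℕ → Setoid 0ℓ 0ℓ
permutationSetoid n = record
  { Carrier       = Permutation′ n
  ; _≈_           = _≈ₚ_
  ; isEquivalence = record
    { refl  = λ _ → refl
    ; sym   = λ p i → sym (p i)
    ; trans = λ p q i → trans (p i) (q i)
    }
  }

-- The one-line notations of length suc n: choose the first entry, then
-- the relative order of the others.

permutations : ∀ n → List (Permutation′ n)
permutations zero    = id ∷ []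
permutations (suc n) = cartesianProductWith (insert Fin.zero) (allFin (suc n)) (permutations n)

insert-cong : ∀ {n} {i j : Fin (suc n)} {π ρ : Permutation′ n} →
              i ≡ j → π ≈ₚ ρ → insert Fin.zero i π ≈ₚ insert Fin.zero j ρ
insert-cong refl     p Fin.zero    = refl
insert-cong {i = i} refl p (Fin.suc k) = cong (punchIn i) (p k)

insert-injective : ∀ {n} {i j : Fin (suc n)} {π ρ : Permutation′ n} →
                   insert Fin.zero i π ≈ₚ insert Fin.zero j ρ → i ≡ j × π ≈ₚ ρ
insert-injective {i = i} p with p Fin.zero
... | refl = refl , λ k → punchIn-injective i _ _ (p (Fin.suc k))

permutations-enumerates : ∀ n → IsEnumeration (permutationSetoid n) (permutations n)
permutations-enumerates zero    π = here λ ()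
permutations-enumerates (suc n) π =
  ∈-resp-≈ (permutationSetoid (suc n)) {x = insert Fin.zero (π ⟨$⟩ʳ Fin.zero) (remove Fin.zero π)} {y = π}
    (insert-remove Fin.zero π)
    (∈-cartesianProductWith⁺ (≡.setoid _) (permutationSetoid n) (permutationSetoid (suc n))
      (λ {i} {j} {ρ} {τ} → insert-cong {i = i} {j} {ρ} {τ})
      (∈-allFin (π ⟨$⟩ʳ Fin.zero))
      (permutations-enumerates n (remove Fin.zero π)))

permutations-unique : ∀ n → Unique (permutationSetoid n) (permutations n)
permutations-unique zero    = [] ∷ []
permutations-unique (suc n) =
  Unique.cartesianProductWith⁺ (≡.setoid _) (permutationSetoid n) (permutationSetoid (suc n))
    (insert Fin.zero) (λ {i} {j} {ρ} {τ} → insert-injective {i = i} {j} {ρ} {τ})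
    (allFin⁺ (suc n)) (permutations-unique n)

card : ∀ {n} {P : Pred (Permutation′ n) 0ℓ} → Decidable P → ℕ
card {n} P? = length (filter P? (permutations n))

Contains1324 : ∀ {n} → Pred (Permutation′ n) 0ℓ
Contains1324 σ = ∃[ i ] ∃[ j ] ∃[ k ] ∃[ l ]
  i Fin.< j × j Fin.< k × k Fin.< l ×
  σ ⟨$⟩ʳ i Fin.< σ ⟨$⟩ʳ k × σ ⟨$⟩ʳ k Fin.< σ ⟨$⟩ʳ j × σ ⟨$⟩ʳ j Fin.< σ ⟨$⟩ʳ l

Avoids1324 : ∀ {n} → Pred (Permutation′ n) 0ℓ
Avoids1324 σ = ¬ Contains1324 σ

-- σ⁻¹(n) − σ⁻¹(a) = k, and σ⁻¹(b) > σ⁻¹(n) for all b < a.  The indices α and ν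
-- stand for the values a and n; when a is not in {1,…,n} no σ qualifies.

Gap : ∀ {n} → ℕ → ℕ → Pred (Permutation′ n) 0ℓ
Gap {n} a k σ = ∃[ α ] ∃[ ν ]
  suc (toℕ α) ≡ a × suc (toℕ ν) ≡ n ×
  toℕ (σ ⟨$⟩ˡ ν) ≡ toℕ (σ ⟨$⟩ˡ α) ℕ.+ k ×
  (∀ β → β Fin.< α → σ ⟨$⟩ˡ ν Fin.< σ ⟨$⟩ˡ β)

S≺ : ∀ n → ℕ → ℕ → Pred (Permutation′ n) 0ℓ
S≺ n a k σ = Avoids1324 σ × Gap a k σ

avoids1324? : ∀ {n} → Decidable (Avoids1324 {n})
avoids1324? σ = ¬? (any? λ i → any? λ j → any? λ k → any? λ l →
  (i Fin.<? j) ×-dec (j Fin.<? k) ×-dec (k Fin.<? l) ×-dec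
  (σ ⟨$⟩ʳ i Fin.<? σ ⟨$⟩ʳ k) ×-dec (σ ⟨$⟩ʳ k Fin.<? σ ⟨$⟩ʳ j) ×-dec (σ ⟨$⟩ʳ j Fin.<? σ ⟨$⟩ʳ l))

gap? : ∀ {n} a k → Decidable (Gap {n} a k)
gap? {n} a k σ = any? λ α → any? λ ν →
  (suc (toℕ α) ≟ a) ×-dec (suc (toℕ ν) ≟ n) ×-dec
  (toℕ (σ ⟨$⟩ˡ ν) ≟ toℕ (σ ⟨$⟩ˡ α) ℕ.+ k) ×-dec
  all? (λ β → (β Fin.<? α) →-dec (σ ⟨$⟩ˡ ν Fin.<? σ ⟨$⟩ˡ β))

S≺? : ∀ n a k → Decidable (S≺ n a k)
S≺? n a k σ = avoids1324? σ ×-dec gap? a k σ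

∣S≺∣ : ℕ → ℕ → ℕ → ℕ
∣S≺∣ n a k = card (S≺? n a k)

a : ℕ → ℕ → ℕ
a n k = ∣S≺∣ n 1 k

∑-syntax : ℕ → ℕ → (ℕ → ℕ) → ℕ
∑-syntax l u F = sum (map F (applyUpTo (λ i → l ℕ.+ i) (suc u ∸ l)))

infix 5 ∑-syntax
syntax ∑-syntax l u (λ m → e) = ∑[ m ∈ l ⋯ u ] e

-- R⟦X⟧ as coefficient sequences with the Cauchy product.

powerSeries : ∀ {c ℓ} → RawRing c ℓ → RawRing c ℓ
powerSeries R = record
  { Carrier = ℕ → Carrier
  ; _≈_     = λ p q → ∀ n → p n ≈ q n
  ; _+_     = λ p q n → p n ⊕ q n
  ; _*_     = λ p q n → Σ {suc n} (λ i → p (toℕ i) ⊛ q (n ∸ toℕ i))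
  ; -_      = λ p n → ⊖ p n
  ; 0#      = λ _ → 0#
  ; 1#      = λ { zero → 1# ; (suc _) → 0# }
  }
  where
  open RawRing R renaming (_+_ to _⊕_; _*_ to _⊛_; -_ to ⊖_)
  open RawSemiringDefs rawSemiring renaming (sum to Σ)

module PowerSeries {c ℓ} (R : RawRing c ℓ) where
  open RawRing R using () renaming (Carrier to A; 0# to 0ᴿ; 1# to 1ᴿ)
  open RawRing (powerSeries R) public
  open RawSemiringDefs rawSemiring public using (_^_)

  infixl 6 _-_
  _-_ : Carrier → Carrier → Carrier
  p - q = p + (- q)

  const : A → Carrier
  const r zero    = r
  const r (suc _) = 0ᴿ

  var : Carrier
  var (suc zero) = 1ᴿ
  var _          = 0ᴿ

  -- h = p / q in the ring: q is a unit and h is p times its inverse.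
  infix 4 _≈_/_
  _≈_/_ : Carrier → Carrier → Carrier → Set _
  h ≈ p / q = ∃[ u ] (q * u ≈ 1# × h ≈ p * u)

-- ℤ⟦x,t⟧ is ℤ⟦x⟧⟦t⟧: h k n is the coefficient of tᵏxⁿ.

module X  = PowerSeries +-*-rawRing
module XT = PowerSeries (powerSeries +-*-rawRing)

x : X.Carrier
x = X.var

t : XT.Carrier
t = XT.var

T : ℕ → ℕ → X.Carrier
T a k n = if does (suc k ≤? n) then + ∣S≺∣ n a k else 0ℤ

g : ℕ → XT.Carrier
g a zero    = X.0#
g a (suc k) = T a (suc k)

f : X.Carrier
f zero    = 0ℤ
f (suc n) = + a (suc (suc n)) 1

-- Let σ = L 1 c₁ ⋯ c_{k-1} n R avoid 1324 and put e = c₁, where k ≥ 2.  The entries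
-- between 1 and n increase, and both in L and in R the entries above e precede those
-- below e, since u v e n with u < e < v in L and 1 e u v with u < e < v in R are
-- occurrences of 1324.  So σ = A B 1 e M n C D with A, M, n, C above e and B, D below it,
-- and σ is determined by its entries ≤ e, the word B 1 e D, and its entries ≥ e, the word
-- A e M n C.  Conversely any two such avoiding words splice to an avoiding one.  Hence
-- T_{1,k} = f T_{1,k-1}, and g₁ is a geometric series in t f.

module Submission where

open import Defs
open import Algebra.Bundles using (Monoid)
open import Algebra.Bundles.Raw using (RawRing)
open import Algebra.Definitions using (Congruent₂; LeftZero)
import Algebra.Properties.Monoid.Sum as MonoidSum
open import Algebra.Structures using (IsMonoid)
open import Data.Empty using (⊥)
open import Data.Fin.Base as Fin using (Fin; toℕ; fromℕ; fromℕ<)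
open import Data.Fin.Permutation
  using (Permutation′; permutation; _⟨$⟩ʳ_; _⟨$⟩ˡ_; inverseˡ; inverseʳ) renaming (_≈_ to _≈ₚ_)
open import Data.Fin.Properties using (toℕ<n; toℕ-injective; toℕ-fromℕ; toℕ-fromℕ<)
open import Data.Integer.Base as ℤ using (ℤ; 0ℤ; +-*-rawRing)
import Data.Integer.Properties as ℤ
open import Data.List.Base
  using ( List; []; _∷_; _++_; length; filter; takeWhile; dropWhile; drop; map; tabulate; lookup
        ; concatMap; applyUpTo; cartesianProduct )
open import Data.List.Membership.Propositional using (_∈_; find; lose)
open import Data.List.Membership.Propositional.Properties
open import Data.List.Membership.Propositional.Properties.WithK using (unique∧set⇒bag)
open import Data.List.Properties
  using ( filter-++; filter-all; filter-none; filter-accept; ++-assoc; ++-identityʳ; ∷-injective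
        ; map-∘; map-id-local; map-cong; length-map; length-++; length-applyUpTo; tabulate-cong
        ; tabulate-lookup )
open import Data.List.Relation.Binary.BagAndSetEquality using (∼bag⇒↭)
open import Data.List.Relation.Binary.Disjoint.Propositional using (Disjoint)
open import Data.List.Relation.Binary.Permutation.Propositional.Properties using (↭-length)
open import Data.List.Relation.Binary.Sublist.Propositional
  using (_⊆_; []; _∷_; _∷ʳ_; minimum; from∈; ⊆-refl; ⊆-trans) renaming (lookup to ⊆-∈)
open import Data.List.Relation.Binary.Sublist.Propositional.Properties
  using (++⁺; ++⁺ˡ; ++⁺ʳ; filter-⊆; filter⁺)
open import Data.List.Relation.Unary.All as All using (All; []; _∷_)
import Data.List.Relation.Unary.All.Properties as All
open import Data.List.Relation.Unary.AllPairs using ([]; _∷_)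
import Data.List.Relation.Unary.AllPairs.Properties as AllPairs
open import Data.List.Relation.Unary.Any using (here; there; index)
open import Data.List.Relation.Unary.Any.Properties using (lookup-index)
open import Data.List.Relation.Unary.Unique.Propositional using (Unique)
import Data.List.Relation.Unary.Unique.Propositional.Properties as Unique
import Data.List.Relation.Unary.Unique.Setoid.Properties as UniqueSetoid
open import Data.Nat.Base using (ℕ; zero; suc; _+_; _*_; _∸_; _≤_; _<_; z≤n; s≤s; z<s; s<s)
open import Data.Nat.ListAction using (sum)
open import Data.Nat.Properties
open import Data.Product.Base using (_×_; _,_; proj₁; proj₂; ∃-syntax)
open import Data.Product.Properties using (,-injectiveˡ; ,-injectiveʳ)
open import Data.Sum.Base using ([_,_]′)
open import Function.Base using (_∘_; id)
open import Function.Bundles using (mk⇔)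
open import Level using (Level; 0ℓ)
open import Relation.Binary.PropositionalEquality
open import Relation.Nullary using (¬_; yes; no; contradiction; ¬?)
open import Relation.Nullary.Decidable using (dec-true; dec-false)
open import Relation.Unary using (Pred; Decidable)

-- Sublists and filters

-- The two words of a splice share the entry `e`, which is the largest value of one and the smallest
-- of the other. They keep their actual values, `0` to `e` and `e` to `d`, instead of being
-- standardized, so that cutting a word is just filtering it by comparison with `e`. All
-- combinatorics is therefore done on lists of naturals that fill an interval, and permutations
-- return only for the counting, through one-line notations shifted by an offset. The sharing also
-- explains the sizes in the recurrence: `m` and `n - m + 1` add up to `n + 1`.

module _ {P : Pred ℕ 0ℓ} (P? : Decidable P) where

  takeWhile-++∷ : ∀ {xs y ys} → All P xs → ¬ P y → takeWhile P? (xs ++ y ∷ ys) ≡ xs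
  takeWhile-++∷ {y = y} [] ¬py with P? y
  ... | yes py = contradiction py ¬py
  ... | no _ = refl
  takeWhile-++∷ {x ∷ _} (px ∷ pxs) ¬py with P? x
  ... | yes _ = cong (x ∷_) (takeWhile-++∷ pxs ¬py)
  ... | no ¬px = contradiction px ¬px

  dropWhile-++∷ : ∀ {xs y ys} → All P xs → ¬ P y → dropWhile P? (xs ++ y ∷ ys) ≡ y ∷ ys
  dropWhile-++∷ {y = y} [] ¬py with P? y
  ... | yes py = contradiction py ¬py
  ... | no _ = refl
  dropWhile-++∷ {x ∷ _} (px ∷ pxs) ¬py with P? x
  ... | yes _ = dropWhile-++∷ pxs ¬py
  ... | no ¬px = contradiction px ¬px

  ⊆-filter : ∀ {xs ys} → All P xs → xs ⊆ ys → xs ⊆ filter P? ys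
  ⊆-filter pxs xs⊆ys = subst (_⊆ _) (filter-all P? pxs) (filter⁺ P? P? (λ { refl → id }) xs⊆ys)

module _ {P : Pred ℕ 0ℓ} where

  -- Pushes an occurrence of 1324 out of an outer block: if its first entry cannot lie in `ws`, no
  -- later entry can either. `⊆-stripʳ` is the mirror image for the last entry.
  ⊆-stripˡ : ∀ {x xs} ws {ys} → All P ws → ¬ P x → x ∷ xs ⊆ ws ++ ys → x ∷ xs ⊆ ys
  ⊆-stripˡ []       []         ¬px τ          = τ
  ⊆-stripˡ (w ∷ ws) (pw ∷ pws) ¬px (.w ∷ʳ τ)  = ⊆-stripˡ ws pws ¬px τ
  ⊆-stripˡ (w ∷ ws) (pw ∷ pws) ¬px (refl ∷ τ) = contradiction pw ¬px

  ⊆-stripʳ : ∀ xs {x} ws {ys} → All P ys → ¬ P x → xs ++ x ∷ [] ⊆ ws ++ ys → xs ++ x ∷ [] ⊆ ws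
  ⊆-stripʳ xs       []       pys ¬px τ = contradiction (All.lookup pys (⊆-∈ τ (∈-++⁺ʳ xs (here refl)))) ¬px
  ⊆-stripʳ []       (w ∷ ws) pys ¬px (.w ∷ʳ τ)  = w ∷ʳ ⊆-stripʳ [] ws pys ¬px τ
  ⊆-stripʳ []       (w ∷ ws) pys ¬px (refl ∷ τ) = refl ∷ minimum ws
  ⊆-stripʳ (x ∷ xs) (w ∷ ws) pys ¬px (.w ∷ʳ τ)  = w ∷ʳ ⊆-stripʳ (x ∷ xs) ws pys ¬px τ
  ⊆-stripʳ (_ ∷ xs) (w ∷ ws) pys ¬px (refl ∷ τ) = refl ∷ ⊆-stripʳ xs ws pys ¬px τ

⊆-++⁻ : ∀ {zs} xs {ys : List ℕ} → zs ⊆ xs ++ ys →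
        ∃[ us ] ∃[ vs ] zs ≡ us ++ vs × us ⊆ xs × vs ⊆ ys
⊆-++⁻ []       τ = [] , _ , refl , [] , τ
⊆-++⁻ (x ∷ xs) (.x ∷ʳ τ) with ⊆-++⁻ xs τ
... | us , vs , eq , σ , ρ = us , vs , eq , x ∷ʳ σ , ρ
⊆-++⁻ (x ∷ xs) (refl ∷ τ) with ⊆-++⁻ xs τ
... | us , vs , eq , σ , ρ = x ∷ us , vs , cong (x ∷_) eq , refl ∷ σ , ρ

-- Avoiding words on an interval of values

Avoiding : Pred (List ℕ) 0ℓ
Avoiding w = ∀ {p q r s} → p ∷ q ∷ r ∷ s ∷ [] ⊆ w → p < r → r < q → q < s → ⊥

-- Phrased through sublists like `Avoiding`, so that both pass to filtered words by transitivity,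
-- and two entries are told apart by exhibiting them in order.
Distinct : Pred (List ℕ) 0ℓ
Distinct w = ∀ {v} → v ∷ v ∷ [] ⊆ w → ⊥

Spaced : ℕ → ℕ → ℕ → Pred (List ℕ) 0ℓ
Spaced s e k w = ∃[ L ] ∃[ M ] ∃[ R ] w ≡ L ++ s ∷ M ++ e ∷ R × suc (length M) ≡ k

-- s and e stand for the paper's 1 and n.
record Word (s e k : ℕ) (w : List ℕ) : Set where
  field
    distinct : Distinct w
    bounded  : ∀ {v} → v ∈ w → s ≤ v × v ≤ e
    full     : ∀ {v} → s ≤ v → v ≤ e → v ∈ w
    avoiding : Avoiding w
    spaced   : Spaced s e k w

distinct-prefix : ∀ {v} L {R} → Distinct (L ++ v ∷ R) → All (_≢ v) L
distinct-prefix L distinct =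
  All.tabulate λ { v∈L refl → distinct (++⁺ (from∈ v∈L) (refl ∷ minimum _)) }

-- Cutting and gluing at a pivot entry

before since : ℕ → List ℕ → List ℕ
before e = takeWhile λ v → ¬? (v ≟ e)
since   e = dropWhile λ v → ¬? (v ≟ e)

before-∷ : ∀ {e L R} → All (_≢ e) L → before e (L ++ e ∷ R) ≡ L
before-∷ {e} L≢e = takeWhile-++∷ (λ v → ¬? (v ≟ e)) L≢e (λ e≢e → e≢e refl)

since-∷ : ∀ {e L R} → All (_≢ e) L → since e (L ++ e ∷ R) ≡ e ∷ R
since-∷ {e} L≢e = dropWhile-++∷ (λ v → ¬? (v ≟ e)) L≢e (λ e≢e → e≢e refl)

-- For `Λ = B e D` and `H = A e C` the result is `A B e C D`; `drop 1` discards the second copy of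
-- the shared `e`.
glue : ℕ → List ℕ → List ℕ → List ℕ
glue e Λ H = before e H ++ before e Λ ++ since e H ++ drop 1 (since e Λ)

second : List ℕ → ℕ
second (_ ∷ v ∷ _) = v
second _           = 0

-- In the words to be cut, `0` is followed by the pivot, so the default value of `second` does not
-- occur there.
pivot : List ℕ → ℕ
pivot w = second (since 0 w)

pivot-∷ : ∀ L {e R} → All (_≢ 0) L → pivot (L ++ 0 ∷ e ∷ R) ≡ e
pivot-∷ L L≢0 = cong second (since-∷ L≢0)

low high : ℕ → List ℕ → List ℕ
low  e = filter (_≤? e)
high e = filter (e ≤?_)

module Splice {e A B C D} (A> : All (e <_) A) (B< : All (_< e) B)
              (C> : All (e <_) C) (D< : All (_< e) D) where

  σ : List ℕ
  σ = A ++ B ++ (e ∷ C) ++ D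

  low-σ : low e σ ≡ B ++ e ∷ D
  low-σ
    rewrite filter-++ (_≤? e) A (B ++ (e ∷ C) ++ D)
          | filter-++ (_≤? e) B ((e ∷ C) ++ D)
          | filter-++ (_≤? e) (e ∷ C) D
          | filter-none (_≤? e) (All.map <⇒≱ A>)
          | filter-all (_≤? e) (All.map <⇒≤ B<)
          | filter-accept (_≤? e) {xs = C} (≤-refl {e})
          | filter-none (_≤? e) (All.map <⇒≱ C>)
          | filter-all (_≤? e) (All.map <⇒≤ D<)
          = refl

  high-σ : high e σ ≡ A ++ e ∷ C
  high-σ
    rewrite filter-++ (e ≤?_) A (B ++ (e ∷ C) ++ D)
          | filter-++ (e ≤?_) B ((e ∷ C) ++ D)
          | filter-++ (e ≤?_) (e ∷ C) D
          | filter-all (e ≤?_) (All.map <⇒≤ A>)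
          | filter-none (e ≤?_) (All.map <⇒≱ B<)
          | filter-accept (e ≤?_) {xs = C} (≤-refl {e})
          | filter-all (e ≤?_) (All.map <⇒≤ C>)
          | filter-none (e ≤?_) (All.map <⇒≱ D<)
          | ++-identityʳ C
          = refl

  glue-σ : glue e (B ++ e ∷ D) (A ++ e ∷ C) ≡ σ
  glue-σ
    rewrite before-∷ {e} {A} {C} (All.map >⇒≢ A>) | before-∷ {e} {B} {D} (All.map <⇒≢ B<)
          | since-∷ {e} {A} {C} (All.map >⇒≢ A>) | since-∷ {e} {B} {D} (All.map <⇒≢ B<)
          = refl

  -- An occurrence on one side of `e` survives in the corresponding half. One that reaches both
  -- below and above `e` can have one of its ends exchanged for the shared `e`, which again puts it
  -- inside a half.
  avoiding-σ : Avoiding (B ++ e ∷ D) → Avoiding (A ++ e ∷ C) → Avoiding σ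
  avoiding-σ low-avoids high-avoids {p} {q} {r} {s} τ p<r r<q q<s with e ≤? p | s ≤? e
  ... | yes e≤p | _ = high-avoids
    (subst (_ ⊆_) high-σ (⊆-filter (e ≤?_) (e≤p ∷ e≤q ∷ e≤r ∷ ≤-trans e≤q (<⇒≤ q<s) ∷ []) τ))
    p<r r<q q<s
    where e≤r = ≤-trans e≤p (<⇒≤ p<r)
          e≤q = ≤-trans e≤r (<⇒≤ r<q)
  ... | no _ | yes s≤e = low-avoids
    (subst (_ ⊆_) low-σ (⊆-filter (_≤? e) (≤-trans (<⇒≤ p<r) r≤e ∷ q≤e ∷ r≤e ∷ s≤e ∷ []) τ))
    p<r r<q q<s
    where q≤e = ≤-trans (<⇒≤ q<s) s≤e
          r≤e = ≤-trans (<⇒≤ r<q) q≤e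
  -- Now `p < e < s`, so `p` is not in `A` and `s` is not in `D`: the occurrence lies in `B e C`.
  -- The cases count its entries in `B`.
  ... | no e≰p | no s≰e with ⊆-++⁻ B (⊆-stripʳ (p ∷ q ∷ r ∷ []) (B ++ e ∷ C) D< (s≰e ∘ <⇒≤)
                               (subst (_ ⊆_) (sym (++-assoc B (e ∷ C) D)) (⊆-stripˡ A A> (e≰p ∘ <⇒≤) τ)))
  ... | [] , _ , refl , _ , ρ = e≰p (All.lookup e≤ (⊆-∈ ρ (here refl)))
    where e≤ = ≤-refl ∷ All.map <⇒≤ C>
  ... | _ ∷ [] , _ , refl , _ , refl ∷ ρ = <-asym r<q (All.lookup C> (⊆-∈ ρ (here refl)))
  -- Only `p` lies in `B`: exchanged for `e`, it gives the occurrence `e q r s` in `A e C`.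
  ... | _ ∷ [] , _ , refl , _ , _ ∷ʳ ρ =
    high-avoids (++⁺ˡ A (refl ∷ ρ)) (All.lookup C> (⊆-∈ ρ (there (here refl)))) r<q q<s
  ... | _ ∷ _ ∷ [] , _ , refl , υ , ρ =
    <-asym r<q (<-≤-trans (All.lookup B< (⊆-∈ υ (there (here refl)))) (All.lookup e≤ (⊆-∈ ρ (here refl))))
    where e≤ = ≤-refl ∷ All.map <⇒≤ C>
  -- All but `s` lie in `B`: exchanging `s` for `e` gives the occurrence `p q r e` in `B e D`.
  ... | _ ∷ _ ∷ _ ∷ [] , _ , refl , υ , _ =
    low-avoids (++⁺ υ (refl ∷ minimum _)) p<r r<q (All.lookup B< (⊆-∈ υ (there (here refl))))
  ... | _ ∷ _ ∷ _ ∷ _ ∷ [] , [] , refl , υ , _ =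
    s≰e (<⇒≤ (All.lookup B< (⊆-∈ υ (there (there (there (here refl)))))))

-- Decomposing a word at its pivot

separate : ∀ {e} xs → All (_≢ e) xs → (∀ {u v} → u ∷ v ∷ [] ⊆ xs → u < e → e < v → ⊥) →
           ∃[ A ] ∃[ B ] xs ≡ A ++ B × All (e <_) A × All (_< e) B
separate [] [] _ = [] , [] , refl , [] , []
separate {e} (x ∷ xs) (x≢e ∷ xs≢e) inv with e <? x
... | yes e<x with separate xs xs≢e (λ τ → inv (x ∷ʳ τ))
...   | A , B , eq , A> , B< = x ∷ A , B , cong (x ∷_) eq , e<x ∷ A> , B<
-- The first entry below `e` ends `A`, since a later entry above `e` would contradict `inv`.
separate {e} (x ∷ xs) (x≢e ∷ xs≢e) inv | no e≮x =
  [] , x ∷ xs , refl , [] , x<e ∷ All.tabulate λ {v} v∈xs →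
    ≤∧≢⇒< (≮⇒≥ (inv (refl ∷ from∈ v∈xs) x<e)) (All.lookup xs≢e v∈xs)
  where x<e = ≤∧≢⇒< (≮⇒≥ e≮x) x≢e

-- The block form common to both directions of the bijection: `decompose` finds it in a word,
-- `recompose` builds it from two halves. The bracketing in `w≡` matches `Spaced`, with `L = A ++ B`
-- and `R = C ++ D`.
record Decomposition (d k e : ℕ) (w : List ℕ) : Set where
  field
    {A B M C D} : List ℕ
    0<e         : 0 < e
    A>          : All (e <_) A
    B<          : All (_< e) B
    C>          : All (e <_) (M ++ d ∷ C)
    D<          : All (_< e) D
    length-M    : length M ≡ k
    w≡          : w ≡ (A ++ B) ++ 0 ∷ e ∷ M ++ d ∷ C ++ D

  -- The lower block of `Splice` absorbs the entry `0`, and its block `C` is `M ++ d ∷ C`.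
  open Splice {B = B ++ 0 ∷ []} A> (All.++⁺ B< (0<e ∷ [])) C> D< public

  w≡σ : w ≡ σ
  w≡σ = begin
    w                                            ≡⟨ w≡ ⟩
    (A ++ B) ++ 0 ∷ e ∷ M ++ d ∷ C ++ D          ≡⟨ ++-assoc A B _ ⟩
    A ++ B ++ 0 ∷ e ∷ M ++ d ∷ C ++ D            ≡⟨ cong (A ++_) (++-assoc B (0 ∷ []) _) ⟨
    A ++ (B ++ 0 ∷ []) ++ e ∷ M ++ d ∷ C ++ D
      ≡⟨ cong (λ v → A ++ (B ++ 0 ∷ []) ++ e ∷ v) (++-assoc M (d ∷ C) D) ⟨
    σ                                            ∎
    where open ≡-Reasoning

  low≡ : low e w ≡ B ++ 0 ∷ e ∷ D
  low≡ = trans (cong (low e) w≡σ) (trans low-σ (++-assoc B (0 ∷ []) (e ∷ D)))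

  high≡ : high e w ≡ A ++ e ∷ M ++ d ∷ C
  high≡ = trans (cong (high e) w≡σ) high-σ

  e<d : e < d
  e<d = All.lookup C> (∈-++⁺ʳ M (here refl))

  glue≡ : glue e (low e w) (high e w) ≡ w
  glue≡ = begin
    glue e (low e w) (high e w)                              ≡⟨ cong (λ v → glue e (low e v) (high e v)) w≡σ ⟩
    glue e (low e σ) (high e σ)                              ≡⟨ cong₂ (glue e) low-σ high-σ ⟩
    glue e ((B ++ 0 ∷ []) ++ e ∷ D) (A ++ e ∷ M ++ d ∷ C)    ≡⟨ glue-σ ⟩
    σ                                                        ≡⟨ w≡σ ⟨
    w                                                        ∎
    where open ≡-Reasoning

  pivot≡ : Distinct w → pivot w ≡ e
  pivot≡ distinct = trans (cong pivot w≡)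
    (pivot-∷ (A ++ B) (distinct-prefix (A ++ B) (subst Distinct w≡ distinct)))

  low-Word : Word 0 d (2 + k) w → Word 0 e 1 (low e w)
  low-Word W = record
    { distinct = λ τ → distinct (⊆-trans τ (filter-⊆ (_≤? e) w))
    ; bounded  = λ v∈ → z≤n , proj₂ (∈-filter⁻ (_≤? e) {xs = w} v∈)
    ; full     = λ 0≤v v≤e → ∈-filter⁺ (_≤? e) (full 0≤v (≤-trans v≤e (<⇒≤ e<d))) v≤e
    ; avoiding = λ τ → avoiding (⊆-trans τ (filter-⊆ (_≤? e) w))
    ; spaced   = B , [] , D , low≡ , refl
    }
    where open Word W

  high-Word : Word 0 d (2 + k) w → Word e d (1 + k) (high e w)
  high-Word W = record
    { distinct = λ τ → distinct (⊆-trans τ (filter-⊆ (e ≤?_) w))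
    ; bounded  = λ v∈ → let v∈w , e≤v = ∈-filter⁻ (e ≤?_) {xs = w} v∈ in e≤v , proj₂ (bounded v∈w)
    ; full     = λ e≤v v≤d → ∈-filter⁺ (e ≤?_) (full z≤n v≤d) e≤v
    ; avoiding = λ τ → avoiding (⊆-trans τ (filter-⊆ (e ≤?_) w))
    ; spaced   = A , M , C , high≡ , cong suc length-M
    }
    where open Word W

  -- Comparing a single value with `e` settles repetitions, bounds and fullness in one of the
  -- halves. Avoidance involves entries from both halves at once and goes through `avoiding-σ`.
  glued-Word : Word 0 e 1 (low e w) → Word e d (1 + k) (high e w) → Word 0 d (2 + k) w
  glued-Word Λ H = record
    { distinct = λ {v} τ → [ (λ v≤e → Λ.distinct (⊆-filter (_≤? e) (v≤e ∷ v≤e ∷ []) τ))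
                           , (λ e≤v → H.distinct (⊆-filter (e ≤?_) (e≤v ∷ e≤v ∷ []) τ)) ]′ (≤-total v e)
    ; bounded  = λ {v} v∈w → z≤n , [ (λ v≤e → ≤-trans v≤e (<⇒≤ e<d))
                                   , (λ e≤v → proj₂ (H.bounded (∈-filter⁺ (e ≤?_) v∈w e≤v))) ]′ (≤-total v e)
    ; full     = λ {v} 0≤v v≤d → [ (λ v≤e → proj₁ (∈-filter⁻ (_≤? e) {xs = w} (Λ.full 0≤v v≤e)))
                                 , (λ e≤v → proj₁ (∈-filter⁻ (e ≤?_) {xs = w} (H.full e≤v v≤d))) ]′ (≤-total v e)
    ; avoiding = subst Avoiding (sym w≡σ)
                   (avoiding-σ (subst Avoiding (trans (cong (low e) w≡σ) low-σ) Λ.avoiding)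
                               (subst Avoiding high≡ H.avoiding))
    ; spaced   = A ++ B , e ∷ M , C ++ D , w≡ , cong (2 +_) length-M
    }
    where module Λ = Word Λ
          module H = Word H

module Interior {d k} L e M R (W : Word 0 d k (L ++ 0 ∷ e ∷ M ++ d ∷ R)) where

  open Word W

  ordered-≢ : ∀ {u v} → u ∷ v ∷ [] ⊆ L ++ 0 ∷ e ∷ M ++ d ∷ R → u ≢ v
  ordered-≢ τ refl = distinct τ

  after-0 : ∀ {v} → v ∈ e ∷ M ++ d ∷ R → 0 < v
  after-0 v∈ = n≢0⇒n>0 (≢-sym (ordered-≢ (++⁺ˡ L (refl ∷ from∈ v∈))))

  before-d : ∀ {v} → v ∈ L ++ 0 ∷ e ∷ M → v < d
  before-d {v} v∈ = ≤∧≢⇒< (proj₂ (bounded (⊆-∈ (subst (_ ⊆_) assoc (++⁺ʳ _ ⊆-refl)) v∈)))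
                      (ordered-≢ (subst (v ∷ d ∷ [] ⊆_) assoc (++⁺ (from∈ v∈) (refl ∷ minimum R))))
    where assoc = ++-assoc L (0 ∷ e ∷ M) (d ∷ R)

  -- An entry `v < e` of `M` would make `0 e v d` an occurrence of 1324.
  M> : All (e <_) M
  M> = All.tabulate λ {v} v∈M → ≤∧≢⇒<
    (≮⇒≥ λ v<e → avoiding (++⁺ˡ L (refl ∷ refl ∷ ++⁺ (from∈ v∈M) (refl ∷ minimum R)))
      (after-0 (there (∈-++⁺ˡ v∈M))) v<e (before-d (∈-++⁺ʳ L (there (here refl)))))
    (ordered-≢ (++⁺ˡ L (0 ∷ʳ refl ∷ from∈ (∈-++⁺ˡ v∈M))))

  separate-L : ∃[ A ] ∃[ B ] L ≡ A ++ B × All (e <_) A × All (_< e) B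
  separate-L = separate L (All.tabulate λ v∈L → ordered-≢ (++⁺ (from∈ v∈L) (0 ∷ʳ refl ∷ minimum _)))
    λ τ u<e e<v → avoiding (++⁺ τ (0 ∷ʳ refl ∷ ++⁺ˡ M (refl ∷ minimum R))) u<e e<v
                    (before-d (∈-++⁺ˡ (⊆-∈ τ (there (here refl)))))

  separate-R : ∃[ C ] ∃[ D ] R ≡ C ++ D × All (e <_) C × All (_< e) D
  separate-R = separate R
    (All.tabulate λ v∈R → ≢-sym (ordered-≢ (++⁺ˡ L (0 ∷ʳ refl ∷ ++⁺ˡ M (d ∷ʳ from∈ v∈R)))))
    λ τ u<e e<v → avoiding (++⁺ˡ L (refl ∷ refl ∷ ++⁺ˡ M (d ∷ʳ τ)))
                    (after-0 (there (∈-++⁺ʳ M (there (⊆-∈ τ (here refl)))))) u<e e<v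

decompose : ∀ {d k w} → Word 0 d (2 + k) w → ∃[ e ] Decomposition d k e w
decompose W with Word.spaced W
... | L , e ∷ M , R , refl , refl with Interior.separate-L L e M R W | Interior.separate-R L e M R W
... | A , B , refl , A> , B< | C , D , refl , C> , D< = e , record
  { 0<e = after-0 (here refl)
  ; A> = A> ; B< = B<
  ; C> = All.++⁺ M> (before-d (∈-++⁺ʳ (A ++ B) (there (here refl))) ∷ C>)
  ; D< = D<
  ; length-M = refl
  ; w≡ = refl
  }
  where open Interior (A ++ B) e M (C ++ D) W

recompose : ∀ {d k e Λ H} → Word 0 e 1 Λ → Word e d (1 + k) H →
            ∃[ w ] Decomposition d k e w × low e w ≡ Λ × high e w ≡ H
recompose {d} {k} {e} ΛW HW with Word.spaced ΛW | Word.spaced HW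
... | B , [] , D , refl , refl | A , M , C , refl , refl =
  -- The spliced word is left to unification: `w≡ = refl` in `dec` determines it.
  _ , dec , Decomposition.low≡ dec , Decomposition.high≡ dec
  where
  module Λ = Word ΛW
  module H = Word HW
  Λ≢ : ∀ {u v} → u ∷ v ∷ [] ⊆ B ++ 0 ∷ e ∷ D → u ≢ v
  Λ≢ τ refl = Λ.distinct τ
  H≢ : ∀ {u v} → u ∷ v ∷ [] ⊆ A ++ e ∷ M ++ d ∷ C → u ≢ v
  H≢ τ refl = H.distinct τ
  Λ< : ∀ {v} → v ∈ B ++ 0 ∷ e ∷ D → v ≢ e → v < e
  Λ< v∈ = ≤∧≢⇒< (proj₂ (Λ.bounded v∈))
  H> : ∀ {v} → v ∈ A ++ e ∷ M ++ d ∷ C → e ≢ v → e < v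
  H> v∈ = ≤∧≢⇒< (proj₁ (H.bounded v∈))
  dec : Decomposition d k e _
  dec = record
    { 0<e = n≢0⇒n>0 (≢-sym (Λ≢ (++⁺ˡ B (refl ∷ refl ∷ minimum D))))
    ; A>  = All.tabulate λ v∈ → H> (∈-++⁺ˡ v∈) (≢-sym (H≢ (++⁺ (from∈ v∈) (refl ∷ minimum _))))
    ; B<  = All.tabulate λ v∈ → Λ< (∈-++⁺ˡ v∈) (Λ≢ (++⁺ (from∈ v∈) (0 ∷ʳ refl ∷ minimum _)))
    ; C>  = All.tabulate λ v∈ → H> (∈-++⁺ʳ A (there v∈)) (H≢ (++⁺ˡ A (refl ∷ from∈ v∈)))
    ; D<  = All.tabulate λ v∈ → Λ< (∈-++⁺ʳ B (there (there v∈))) (≢-sym (Λ≢ (++⁺ˡ B (0 ∷ʳ refl ∷ from∈ v∈))))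
    ; length-M = refl
    ; w≡ = refl
    }

-- One-line notations as words

unique⇒distinct : ∀ {w} → Unique w → Distinct w
unique⇒distinct (_ ∷ uw)  (_ ∷ʳ τ)   = unique⇒distinct uw τ
unique⇒distinct (x∉ ∷ _) (refl ∷ τ) = All.lookup x∉ (⊆-∈ τ (here refl)) refl

distinct⇒unique : ∀ w → Distinct w → Unique w
distinct⇒unique []      _        = []
distinct⇒unique (x ∷ w) distinct =
  All.tabulate (λ { v∈w refl → distinct (refl ∷ from∈ v∈w) }) ∷ distinct⇒unique w λ τ → distinct (x ∷ʳ τ)

module _ {ℓ : Level} {A : Set ℓ} where

  length-≡ : ∀ {xs ys : List A} → Unique xs → Unique ys →
             (∀ {v} → v ∈ xs → v ∈ ys) → (∀ {v} → v ∈ ys → v ∈ xs) → length xs ≡ length ys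
  length-≡ uxs uys xs⊆ys ys⊆xs = ↭-length (∼bag⇒↭ (unique∧set⇒bag uxs uys (mk⇔ xs⊆ys ys⊆xs)))

  ⊆-tabulate₁ : ∀ {n} {f : Fin n → A} i → f i ∷ [] ⊆ tabulate f
  ⊆-tabulate₁ i = from∈ (∈-tabulate⁺ i)

  ⊆-tabulate₂ : ∀ {n} {f : Fin n → A} i j → i Fin.< j → f i ∷ f j ∷ [] ⊆ tabulate f
  ⊆-tabulate₂ Fin.zero    (Fin.suc j) _         = refl ∷ ⊆-tabulate₁ j
  ⊆-tabulate₂ (Fin.suc i) (Fin.suc j) (s<s i<j) = _ ∷ʳ ⊆-tabulate₂ i j i<j

  ⊆-tabulate₃ : ∀ {n} {f : Fin n → A} i j k → i Fin.< j → j Fin.< k →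
                f i ∷ f j ∷ f k ∷ [] ⊆ tabulate f
  ⊆-tabulate₃ Fin.zero    (Fin.suc j) (Fin.suc k) _         (s<s j<k) = refl ∷ ⊆-tabulate₂ j k j<k
  ⊆-tabulate₃ (Fin.suc i) (Fin.suc j) (Fin.suc k) (s<s i<j) (s<s j<k) = _ ∷ʳ ⊆-tabulate₃ i j k i<j j<k

  ⊆-tabulate₄ : ∀ {n} {f : Fin n → A} i j k l → i Fin.< j → j Fin.< k → k Fin.< l →
                f i ∷ f j ∷ f k ∷ f l ∷ [] ⊆ tabulate f
  ⊆-tabulate₄ Fin.zero    (Fin.suc j) (Fin.suc k) (Fin.suc l) _         (s<s j<k) (s<s k<l) =
    refl ∷ ⊆-tabulate₃ j k l j<k k<l
  ⊆-tabulate₄ (Fin.suc i) (Fin.suc j) (Fin.suc k) (Fin.suc l) (s<s i<j) (s<s j<k) (s<s k<l) =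
    _ ∷ʳ ⊆-tabulate₄ i j k l i<j j<k k<l

  split₁ : ∀ {n} (f : Fin n → A) i → ∃[ M ] ∃[ R ] tabulate f ≡ M ++ f i ∷ R × length M ≡ toℕ i
  split₁ f Fin.zero    = [] , _ , refl , refl
  split₁ f (Fin.suc i) with split₁ (f ∘ Fin.suc) i
  ... | M , R , eq , len = f Fin.zero ∷ M , R , cong (_ ∷_) eq , cong suc len

  split₂ : ∀ {n} (f : Fin n → A) i j {k} → toℕ j ≡ toℕ i + suc k →
           ∃[ L ] ∃[ M ] ∃[ R ] tabulate f ≡ L ++ f i ∷ M ++ f j ∷ R × length M ≡ k
  split₂ f Fin.zero (Fin.suc j) refl with split₁ (f ∘ Fin.suc) j
  ... | M , R , eq , len = [] , M , R , cong (_ ∷_) eq , len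
  split₂ f (Fin.suc i) (Fin.suc j) eq with split₂ (f ∘ Fin.suc) i j (suc-injective eq)
  ... | L , M , R , eq′ , len = f Fin.zero ∷ L , M , R , cong (_ ∷_) eq′ , len

  unsplit₁ : ∀ {n} (f : Fin n → A) M {v R} → tabulate f ≡ M ++ v ∷ R → ∃[ i ] f i ≡ v × toℕ i ≡ length M
  unsplit₁ {suc n} f []      eq = Fin.zero , proj₁ (∷-injective eq) , refl
  unsplit₁ {suc n} f (_ ∷ M) eq with unsplit₁ (f ∘ Fin.suc) M (proj₂ (∷-injective eq))
  ... | i , fi≡v , i≡ = Fin.suc i , fi≡v , cong suc i≡

  unsplit₂ : ∀ {n} (f : Fin n → A) L {u} M {v R} → tabulate f ≡ L ++ u ∷ M ++ v ∷ R →
             ∃[ i ] ∃[ j ] f i ≡ u × f j ≡ v × toℕ j ≡ toℕ i + suc (length M)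
  unsplit₂ {suc n} f []      M eq with unsplit₁ (f ∘ Fin.suc) M (proj₂ (∷-injective eq))
  ... | j , fj≡v , j≡ = Fin.zero , Fin.suc j , proj₁ (∷-injective eq) , fj≡v , cong suc j≡
  unsplit₂ {suc n} f (_ ∷ L) M eq with unsplit₂ (f ∘ Fin.suc) L M (proj₂ (∷-injective eq))
  ... | i , j , fi≡u , fj≡v , j≡ = Fin.suc i , Fin.suc j , fi≡u , fj≡v , cong suc j≡

  positions₁ : ∀ {n} {f : Fin n → A} {p} → p ∷ [] ⊆ tabulate f → ∃[ i ] f i ≡ p
  positions₁ τ with ∈-tabulate⁻ (⊆-∈ τ (here refl))
  ... | i , p≡ = i , sym p≡

  positions₂ : ∀ {n} {f : Fin n → A} {p q} → p ∷ q ∷ [] ⊆ tabulate f →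
               ∃[ i ] ∃[ j ] i Fin.< j × f i ≡ p × f j ≡ q
  positions₂ {suc n} (refl ∷ τ) with positions₁ τ
  ... | j , refl = Fin.zero , Fin.suc j , z<s , refl , refl
  positions₂ {suc n} (_ ∷ʳ τ) with positions₂ τ
  ... | i , j , i<j , eqs = Fin.suc i , Fin.suc j , s<s i<j , eqs

  positions₃ : ∀ {n} {f : Fin n → A} {p q r} → p ∷ q ∷ r ∷ [] ⊆ tabulate f →
               ∃[ i ] ∃[ j ] ∃[ k ] i Fin.< j × j Fin.< k × f i ≡ p × f j ≡ q × f k ≡ r
  positions₃ {suc n} (refl ∷ τ) with positions₂ τ
  ... | j , k , j<k , eqs = Fin.zero , Fin.suc j , Fin.suc k , z<s , s<s j<k , refl , eqs
  positions₃ {suc n} (_ ∷ʳ τ) with positions₃ τ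
  ... | i , j , k , i<j , j<k , eqs = Fin.suc i , Fin.suc j , Fin.suc k , s<s i<j , s<s j<k , eqs

  positions₄ : ∀ {n} {f : Fin n → A} {p q r s} → p ∷ q ∷ r ∷ s ∷ [] ⊆ tabulate f →
               ∃[ i ] ∃[ j ] ∃[ k ] ∃[ l ] i Fin.< j × j Fin.< k × k Fin.< l ×
                 f i ≡ p × f j ≡ q × f k ≡ r × f l ≡ s
  positions₄ {suc n} (refl ∷ τ) with positions₃ τ
  ... | j , k , l , j<k , k<l , eqs =
    Fin.zero , Fin.suc j , Fin.suc k , Fin.suc l , z<s , s<s j<k , s<s k<l , refl , eqs
  positions₄ {suc n} (_ ∷ʳ τ) with positions₄ τ
  ... | i , j , k , l , i<j , j<k , k<l , eqs =
    Fin.suc i , Fin.suc j , Fin.suc k , Fin.suc l , s<s i<j , s<s j<k , s<s k<l , eqs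

lookup-injective : ∀ {w : List ℕ} → Unique w → ∀ i j → lookup w i ≡ lookup w j → i ≡ j
lookup-injective (_ ∷ _)  Fin.zero    Fin.zero    _  = refl
lookup-injective {_ ∷ w} (v∉ ∷ _) Fin.zero    (Fin.suc j) eq = contradiction eq (All.lookup v∉ (∈-lookup j))
lookup-injective {_ ∷ w} (v∉ ∷ _) (Fin.suc i) Fin.zero    eq = contradiction (sym eq) (All.lookup v∉ (∈-lookup i))
lookup-injective (_ ∷ uw) (Fin.suc i) (Fin.suc j) eq = cong Fin.suc (lookup-injective uw i j eq)

-- Pattern avoidance and the gap are unchanged when all values are shifted. The offset `s` thus lets
-- the same permutations count the upper words, whose values start at `e`.
entry : ∀ {n} → ℕ → Permutation′ n → Fin n → ℕ
entry s σ i = s + toℕ (σ ⟨$⟩ʳ i)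

oneLine : ∀ {n} → ℕ → Permutation′ n → List ℕ
oneLine s σ = tabulate (entry s σ)

entry-injective : ∀ {n} s (σ : Permutation′ n) {i j} → entry s σ i ≡ entry s σ j → i ≡ j
entry-injective s σ eq =
  trans (sym (inverseˡ σ)) (trans (cong (σ ⟨$⟩ˡ_) (toℕ-injective (+-cancelˡ-≡ s _ _ eq))) (inverseˡ σ))

tabulate-injective : ∀ {n} {f g : Fin n → ℕ} → tabulate f ≡ tabulate g → f ≗ g
tabulate-injective eq Fin.zero    = proj₁ (∷-injective eq)
tabulate-injective eq (Fin.suc i) = tabulate-injective (proj₂ (∷-injective eq)) i

oneLine-injective : ∀ {n} s {σ τ : Permutation′ n} → oneLine s σ ≡ oneLine s τ → σ ≈ₚ τ
oneLine-injective s eq i = toℕ-injective (+-cancelˡ-≡ s _ _ (tabulate-injective eq i))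

oneLine-cong : ∀ {n} s {σ τ : Permutation′ n} → σ ≈ₚ τ → oneLine s σ ≡ oneLine s τ
oneLine-cong s σ≈τ = tabulate-cong λ i → cong (λ v → s + toℕ v) (σ≈τ i)

Word-length : ∀ {s d k w} → Word s (s + d) k w → length w ≡ suc d
Word-length {s} {d} {k} {w} W = trans
  (length-≡ (distinct⇒unique w distinct) interval-unique to-interval from-interval)
  (length-applyUpTo (s +_) (suc d))
  where
  open Word W
  interval = applyUpTo (s +_) (suc d)
  interval-unique : Unique interval
  interval-unique = Unique.applyUpTo⁺₁ (s +_) (suc d) λ i<j _ → <⇒≢ i<j ∘ +-cancelˡ-≡ s _ _
  to-interval : ∀ {v} → v ∈ w → v ∈ interval
  to-interval {v} v∈w with bounded v∈w
  ... | s≤v , v≤s+d = subst (_∈ interval) (m+[n∸m]≡n s≤v) (∈-applyUpTo⁺ (s +_) (s≤s (m≤n+o⇒m∸n≤o v s v≤s+d)))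
  from-interval : ∀ {v} → v ∈ interval → v ∈ w
  from-interval v∈ with ∈-applyUpTo⁻ (s +_) v∈
  ... | i , s≤s i≤d , refl = full (m≤m+n s i) (+-monoʳ-≤ s i≤d)

-- The inverse permutation sends a value to the index at which `full` locates it; distinctness of
-- the entries makes it a two-sided inverse.
oneLine-surjective : ∀ {n s} w → length w ≡ n → Distinct w → (∀ {v} → v ∈ w → s ≤ v × v < s + n) →
                     (∀ {v} → s ≤ v → v < s + n → v ∈ w) → ∃[ σ ] oneLine {n} s σ ≡ w
oneLine-surjective {s = s} w refl distinct bounded full =
  permutation to from to-from from-to , trans (tabulate-cong to≡) (tabulate-lookup w)
  where
  unique = distinct⇒unique w distinct
  n = length w
  in-range : ∀ i → lookup w i ∸ s < n
  in-range i = let s≤v , v< = bounded (∈-lookup {xs = w} i) in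
    +-cancelˡ-< s _ _ (subst (_< s + n) (sym (m+[n∸m]≡n s≤v)) v<)
  to : Fin n → Fin n
  to i = fromℕ< (in-range i)
  to≡ : ∀ i → s + toℕ (to i) ≡ lookup w i
  to≡ i = trans (cong (s +_) (toℕ-fromℕ< (in-range i))) (m+[n∸m]≡n (proj₁ (bounded (∈-lookup {xs = w} i))))
  at : ∀ j → s + toℕ j ∈ w
  at j = full (m≤m+n s _) (+-monoʳ-< s (toℕ<n j))
  from : Fin n → Fin n
  from j = index (at j)
  to-from : ∀ j → to (from j) ≡ j
  to-from j = toℕ-injective (+-cancelˡ-≡ s _ _ (trans (to≡ (from j)) (sym (lookup-index (at j)))))
  from-to : ∀ i → from (to i) ≡ i
  from-to i = lookup-injective unique _ _ (trans (sym (lookup-index (at (to i)))) (to≡ i))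

avoids⇒avoiding : ∀ {n} s (σ : Permutation′ n) → Avoids1324 σ → Avoiding (oneLine s σ)
avoids⇒avoiding s σ avoids τ p<r r<q q<s with positions₄ τ
... | i , j , k , l , i<j , j<k , k<l , refl , refl , refl , refl =
  avoids (i , j , k , l , i<j , j<k , k<l ,
          +-cancelˡ-< s _ _ p<r , +-cancelˡ-< s _ _ r<q , +-cancelˡ-< s _ _ q<s)

avoiding⇒avoids : ∀ {n} s (σ : Permutation′ n) → Avoiding (oneLine s σ) → Avoids1324 σ
avoiding⇒avoids s σ avoiding (i , j , k , l , i<j , j<k , k<l , p<r , r<q , q<s) =
  avoiding (⊆-tabulate₄ i j k l i<j j<k k<l) (+-monoʳ-< s p<r) (+-monoʳ-< s r<q) (+-monoʳ-< s q<s)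

gap⇒spaced : ∀ {d k} s (σ : Permutation′ (suc d)) → Gap 1 (suc k) σ → Spaced s (s + d) (suc k) (oneLine s σ)
gap⇒spaced s σ (Fin.zero , ν , refl , ν≡d , gap , _)
  with split₂ (entry s σ) (σ ⟨$⟩ˡ Fin.zero) (σ ⟨$⟩ˡ ν) gap
... | L , M , R , eq , len =
  L , M , R , trans eq (cong₂ (λ u v → L ++ u ∷ M ++ v ∷ R) at-0 at-ν) , cong suc len
  where at-0 = trans (cong (λ i → s + toℕ i) (inverseʳ σ)) (+-identityʳ s)
        at-ν = cong (s +_) (trans (cong toℕ (inverseʳ σ)) (suc-injective ν≡d))

spaced⇒gap : ∀ {d k} s (σ : Permutation′ (suc d)) → Spaced s (s + d) (suc k) (oneLine s σ) → Gap 1 (suc k) σ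
spaced⇒gap {d} s σ (L , M , R , eq , refl) with unsplit₂ (entry s σ) L M eq
... | i , j , i≡ , j≡ , gap =
  Fin.zero , fromℕ d , refl , cong suc (toℕ-fromℕ d) ,
  trans (cong toℕ at-j) (trans gap (cong (λ v → toℕ v + _) (sym at-i))) , λ _ ()
  where
  at-i : σ ⟨$⟩ˡ Fin.zero ≡ i
  at-i = entry-injective s σ (trans (trans (cong (λ i → s + toℕ i) (inverseʳ σ)) (+-identityʳ s)) (sym i≡))
  at-j : σ ⟨$⟩ˡ fromℕ d ≡ j
  at-j = entry-injective s σ (trans (cong (s +_) (trans (cong toℕ (inverseʳ σ)) (toℕ-fromℕ d))) (sym j≡))

-- Opaque, as unification would otherwise unfold the enumeration of the permutations.
opaque

  words : ℕ → ℕ → ℕ → List (List ℕ)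
  words s n k = map (oneLine s) (filter (S≺? n 1 k) (permutations n))

  length-words : ∀ s n k → length (words s n k) ≡ ∣S≺∣ n 1 k
  length-words s n k = length-map (oneLine s) (filter (S≺? n 1 k) (permutations n))

  words-unique : ∀ s n k → Unique (words s n k)
  words-unique s n k =
    UniqueSetoid.map⁺ (permutationSetoid n) (setoid _) (λ {σ} {τ} → oneLine-injective s {σ} {τ})
      (UniqueSetoid.filter⁺ (permutationSetoid n) (S≺? n 1 k) (permutations-unique n))

  words⇒Word : ∀ {s d k w} → w ∈ words s (suc d) (suc k) → Word s (s + d) (suc k) w
  words⇒Word {s} {d} {k} w∈ with ∈-map⁻ (oneLine s) w∈
  ... | σ , σ∈ , refl with ∈-filter⁻ (S≺? (suc d) 1 (suc k)) {xs = permutations (suc d)} σ∈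
  ... | _ , avoids , gap = record
    { distinct = unique⇒distinct (Unique.tabulate⁺ (entry-injective s σ))
    ; bounded  = bounded
    ; full     = full
    ; avoiding = avoids⇒avoiding s σ avoids
    ; spaced   = gap⇒spaced s σ gap
    }
    where
    bounded : ∀ {v} → v ∈ oneLine s σ → s ≤ v × v ≤ s + d
    bounded v∈ with ∈-tabulate⁻ {f = entry s σ} v∈
    ... | i , refl = m≤m+n s _ , +-monoʳ-≤ s (≤-pred (toℕ<n (σ ⟨$⟩ʳ i)))
    full : ∀ {v} → s ≤ v → v ≤ s + d → v ∈ oneLine s σ
    full {v} s≤v v≤s+d = subst (_∈ oneLine s σ) at-v (∈-tabulate⁺ {f = entry s σ} (σ ⟨$⟩ˡ fromℕ< v∸s<))
      where
      v∸s< : v ∸ s < suc d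
      v∸s< = s≤s (m≤n+o⇒m∸n≤o v s v≤s+d)
      at-v : entry s σ (σ ⟨$⟩ˡ fromℕ< v∸s<) ≡ v
      at-v = begin
        entry s σ (σ ⟨$⟩ˡ fromℕ< v∸s<) ≡⟨ cong (λ i → s + toℕ i) (inverseʳ σ) ⟩
        s + toℕ (fromℕ< v∸s<)          ≡⟨ cong (s +_) (toℕ-fromℕ< v∸s<) ⟩
        s + (v ∸ s)                    ≡⟨ m+[n∸m]≡n s≤v ⟩
        v                              ∎
        where open ≡-Reasoning

  Word⇒words : ∀ {s d k w} → Word s (s + d) (suc k) w → w ∈ words s (suc d) (suc k)
  Word⇒words {s} {d} {k} {w} W
    with oneLine-surjective {s = s} w (Word-length W) distinct
           (λ {v} v∈w → let s≤v , v≤s+d = bounded v∈w in s≤v , subst (v <_) (sym (+-suc s d)) (s≤s v≤s+d))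
           (λ {v} s≤v v< → full s≤v (≤-pred (subst (v <_) (+-suc s d) v<)))
    where open Word W
  -- The enumeration contains `σ` only up to pointwise equality; the listed `τ` has the same
  -- one-line notation.
  ... | σ , σ≡w with find (permutations-enumerates (suc d) σ)
  ... | τ , τ∈ , σ≈τ = subst (_∈ words s (suc d) (suc k)) τ≡w
    (∈-map⁺ (oneLine s) (∈-filter⁺ (S≺? (suc d) 1 (suc k)) τ∈
      (avoiding⇒avoids s τ (subst Avoiding (sym τ≡w) avoiding) ,
       spaced⇒gap s τ (subst (Spaced s (s + d) (suc k)) (sym τ≡w) spaced))))
    where
    open Word W
    τ≡w : oneLine s τ ≡ w
    τ≡w = trans (sym (oneLine-cong s {σ} {τ} σ≈τ)) σ≡w

-- Counting by gluing

module _ {ℓ ℓ′ : Level} {A : Set ℓ} {B : Set ℓ′} where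

  bijection-length : ∀ {xs : List A} {ys : List B} (φ : A → B) (ψ : B → A) → Unique xs → Unique ys →
                     (∀ {v} → v ∈ xs → φ v ∈ ys × ψ (φ v) ≡ v) →
                     (∀ {v} → v ∈ ys → ψ v ∈ xs × φ (ψ v) ≡ v) → length xs ≡ length ys
  bijection-length {xs} {ys} φ ψ uxs uys to from =
    trans (sym (length-map φ xs)) (length-≡ φxs-unique uys
      (λ v∈ → let u , u∈ , v≡ = ∈-map⁻ φ v∈ in subst (_∈ ys) (sym v≡) (proj₁ (to u∈)))
      (λ {v} v∈ → subst (_∈ map φ xs) (proj₂ (from v∈)) (∈-map⁺ φ (proj₁ (from v∈)))))
    where
    φxs-unique : Unique (map φ xs)
    -- Mapping `ψ` over `map φ xs` gives back `xs`, which has no repetitions.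
    φxs-unique = Unique.map⁻ {f = ψ}
      (subst Unique (sym (trans (sym (map-∘ xs)) (map-id-local (All.tabulate (proj₂ ∘ to))))) uxs)

  length-cartesianProduct : ∀ (xs : List A) (ys : List B) →
                            length (cartesianProduct xs ys) ≡ length xs * length ys
  length-cartesianProduct []       ys = refl
  length-cartesianProduct (x ∷ xs) ys = trans (length-++ (map (x ,_) ys))
    (cong₂ _+_ (length-map (x ,_) ys) (length-cartesianProduct xs ys))

  length-concatMap : ∀ (h : A → List B) xs → length (concatMap h xs) ≡ sum (map (length ∘ h) xs)
  length-concatMap h []       = refl
  length-concatMap h (x ∷ xs) = trans (length-++ (h x)) (cong (length (h x) +_) (length-concatMap h xs))

-- Here `m` is the length of the lower word, so the shared entry is `m ∸ 1` and the upper word fills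
-- the values from `m ∸ 1` to `d`. Recording the shared entry keeps the lists for different `m`
-- disjoint and tells `glue` where to cut.
gluingsAt : ℕ → ℕ → ℕ → List (ℕ × List ℕ × List ℕ)
gluingsAt d k m = map (m ∸ 1 ,_) (cartesianProduct (words 0 m 1) (words (m ∸ 1) (suc d ∸ m + 1) (suc k)))

gluings : ℕ → ℕ → List (ℕ × List ℕ × List ℕ)
gluings d k = concatMap (gluingsAt d k) (applyUpTo (2 +_) (d ∸ suc k))

gluingsAt-unique : ∀ d k m → Unique (gluingsAt d k m)
gluingsAt-unique d k m = Unique.map⁺ ,-injectiveʳ
  (Unique.cartesianProduct⁺ (words-unique 0 m 1) (words-unique (m ∸ 1) (suc d ∸ m + 1) (suc k)))

gluings-unique : ∀ d k → Unique (gluings d k)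
gluings-unique d k = Unique.concat⁺
  (All.map⁺ (All.universal (gluingsAt-unique d k) (applyUpTo (2 +_) (d ∸ suc k))))
  (AllPairs.map⁺ (AllPairs.applyUpTo⁺₁ (2 +_) (d ∸ suc k) λ i<j _ → disjoint i<j))
  where
  disjoint : ∀ {i j} → i < j → Disjoint (gluingsAt d k (2 + i)) (gluingsAt d k (2 + j))
  disjoint i<j (v∈ , v∈′) with ∈-map⁻ _ v∈ | ∈-map⁻ _ v∈′
  ... | _ , _ , refl | _ , _ , eq = <⇒≢ i<j (suc-injective (,-injectiveˡ eq))

length-gluings : ∀ d k → length (gluings d k) ≡
                 sum (map (λ m → a m 1 * a (suc d ∸ m + 1) (suc k)) (applyUpTo (2 +_) (d ∸ suc k)))
length-gluings d k = trans (length-concatMap (gluingsAt d k) tops) (cong sum (map-cong length-gluingsAt tops))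
  where
  tops = applyUpTo (2 +_) (d ∸ suc k)
  length-gluingsAt : ∀ m → length (gluingsAt d k m) ≡ a m 1 * a (suc d ∸ m + 1) (suc k)
  length-gluingsAt m = begin
    length (gluingsAt d k m)
      ≡⟨ length-map _ (cartesianProduct (words 0 m 1) _) ⟩
    length (cartesianProduct (words 0 m 1) (words (m ∸ 1) (suc d ∸ m + 1) (suc k)))
      ≡⟨ length-cartesianProduct (words 0 m 1) _ ⟩
    length (words 0 m 1) * length (words (m ∸ 1) (suc d ∸ m + 1) (suc k))
      ≡⟨ cong₂ _*_ (length-words 0 m 1) (length-words (m ∸ 1) _ (suc k)) ⟩
    a m 1 * a (suc d ∸ m + 1) (suc k)                 ∎
    where open ≡-Reasoning

suc-∸+1 : ∀ d i → suc d ∸ (2 + i) + 1 ≡ suc (d ∸ suc i)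
suc-∸+1 d i = +-comm (d ∸ suc i) 1

spaced-length : ∀ {s e k w} → Spaced s e k w → k < length w
spaced-length {s} {e} (L , M , R , refl , refl)
  rewrite length-++ L {s ∷ M ++ e ∷ R} | length-++ M {e ∷ R} =
  ≤-trans (s≤s (m<m+n (length M) z<s)) (m≤n+m _ (length L))

-- The upper limit on `m` comes from the upper word: a gap of `suc k` takes at least `2 + k` entries
-- among the values `e` to `d`, hence `e + suc k ≤ d`.
∈-gluings⁺ : ∀ {d k e Λ H} → 0 < e → e < d → Word 0 e 1 Λ → Word e d (1 + k) H → (e , Λ , H) ∈ gluings d k
∈-gluings⁺ {d} {k} {suc i} {Λ} {H} _ e<d ΛW HW =
  ∈-concatMap⁺ (gluingsAt d k) (lose (∈-applyUpTo⁺ (2 +_) i<)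
    (∈-map⁺ _ (∈-cartesianProduct⁺ (Word⇒words ΛW)
      (subst (λ n → H ∈ words (suc i) n (suc k)) (sym (suc-∸+1 d i)) (Word⇒words HW′)))))
  where
  HW′ : Word (suc i) (suc i + (d ∸ suc i)) (suc k) H
  HW′ = subst (λ d → Word (suc i) d (suc k) H) (sym (m+[n∸m]≡n (<⇒≤ e<d))) HW
  k≤ : suc k ≤ d ∸ suc i
  k≤ = ≤-pred (subst (suc k <_) (Word-length HW′) (spaced-length (Word.spaced HW′)))
  i< : i < d ∸ suc k
  i< = m+n≤o⇒m≤o∸n (suc i) (subst (suc i + suc k ≤_) (m+[n∸m]≡n (<⇒≤ e<d)) (+-monoʳ-≤ (suc i) k≤))

∈-gluings⁻ : ∀ {d k e Λ H} → (e , Λ , H) ∈ gluings d k → Word 0 e 1 Λ × Word e d (1 + k) H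
∈-gluings⁻ {d} {k} {e} {Λ} {H} v∈
  with find (∈-concatMap⁻ (gluingsAt d k) {xs = applyUpTo (2 +_) (d ∸ suc k)} v∈)
... | m , m∈ , v∈m with ∈-applyUpTo⁻ (2 +_) m∈ | ∈-map⁻ (m ∸ 1 ,_) v∈m
... | i , i< , refl | _ , ΛH∈ , refl
  with ∈-cartesianProduct⁻ (words 0 m 1) (words e (suc d ∸ m + 1) (suc k)) ΛH∈
... | Λ∈ , H∈ = words⇒Word Λ∈ ,
  subst (λ d → Word e d (suc k) H) (m+[n∸m]≡n e≤d)
    (words⇒Word (subst (λ n → H ∈ words e n (suc k)) (suc-∸+1 d i) H∈))
  where
  e≤d : e ≤ d
  e≤d = ≤-trans i< (m∸n≤m d (suc k))

recurrence : ∀ d k → a (suc d) (2 + k) ≡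
             sum (map (λ m → a m 1 * a (suc d ∸ m + 1) (suc k)) (applyUpTo (2 +_) (d ∸ suc k)))
recurrence d k = begin
  a (suc d) (2 + k)                ≡⟨ length-words 0 (suc d) (2 + k) ⟨
  length (words 0 (suc d) (2 + k))
    ≡⟨ bijection-length split join (words-unique 0 (suc d) (2 + k)) (gluings-unique d k)
         split-join join-split ⟩
  length (gluings d k)             ≡⟨ length-gluings d k ⟩
  _                                ∎
  where
  open ≡-Reasoning
  split : List ℕ → ℕ × List ℕ × List ℕ
  split w = pivot w , low (pivot w) w , high (pivot w) w
  join : ℕ × List ℕ × List ℕ → List ℕ
  join (e , Λ , H) = glue e Λ H
  split-join : ∀ {w} → w ∈ words 0 (suc d) (2 + k) → split w ∈ gluings d k × join (split w) ≡ w
  split-join {w} w∈ with words⇒Word w∈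
  ... | W with decompose W
  -- Abstracting `pivot w` together with its equation turns the computed pivot into the `e` of the
  -- decomposition. The same device below replaces the glued word by `w`.
  ... | e , dec with pivot w | Decomposition.pivot≡ dec (Word.distinct W)
  ... | _ | refl = ∈-gluings⁺ 0<e e<d (low-Word W) (high-Word W) , glue≡
    where open Decomposition dec
  join-split : ∀ {v} → v ∈ gluings d k → join v ∈ words 0 (suc d) (2 + k) × split (join v) ≡ v
  join-split {e , Λ , H} v∈ with ∈-gluings⁻ {d} {k} v∈
  ... | ΛW , HW with recompose ΛW HW
  ... | w , dec , refl , refl with glue e (low e w) (high e w) | Decomposition.glue≡ dec
  ... | _ | refl = Word⇒words W , cong (λ e → e , low e w , high e w) (pivot≡ (Word.distinct W))
    where
    open Decomposition dec
    W = glued-Word ΛW HW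

-- Power series

-- The assumptions on `R` are few enough to be inherited by its power series, as the `series-`
-- lemmas show. The module therefore applies to ℤ and again to ℤ⟦x⟧, without establishing the full
-- ring laws.
module Coefficients {c ℓ} (R : RawRing c ℓ)
  (+-isMonoid : IsMonoid (RawRing._≈_ R) (RawRing._+_ R) (RawRing.0# R))
  (*-cong : Congruent₂ (RawRing._≈_ R) (RawRing._*_ R))
  (zeroˡ : LeftZero (RawRing._≈_ R) (RawRing.0# R) (RawRing._*_ R)) where

  open RawRing R renaming (_+_ to _⊕_; _*_ to _⊛_)

  private
    +-monoid : Monoid c ℓ
    +-monoid = record { isMonoid = +-isMonoid }
    module + = Monoid +-monoid
    module P = RawRing (powerSeries R)

  open MonoidSum +-monoid using (sum-cong-≋; sum-replicate-zero) renaming (sum to Σ)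

  sum-zero : ∀ n (φ : Fin n → Carrier) → (∀ i → φ i ≈ 0#) → Σ φ ≈ 0#
  sum-zero n φ φ≈0 = +.trans (sum-cong-≋ φ≈0) (sum-replicate-zero n)

  series-+-isMonoid : IsMonoid P._≈_ P._+_ P.0#
  series-+-isMonoid = record
    { isSemigroup = record
      { isMagma = record
        { isEquivalence = record
          { refl = λ _ → +.refl ; sym = λ p n → +.sym (p n) ; trans = λ p q n → +.trans (p n) (q n) }
        ; ∙-cong = λ p q n → +.∙-cong (p n) (q n)
        }
      ; assoc = λ p q r n → +.assoc (p n) (q n) (r n)
      }
    ; identity = (λ p n → +.identityˡ (p n)) , (λ p n → +.identityʳ (p n))
    }

  series-*-cong : Congruent₂ P._≈_ P._*_
  series-*-cong p q n = sum-cong-≋ {suc n} λ i → *-cong (p (toℕ i)) (q (n ∸ toℕ i))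

  series-zeroˡ : LeftZero P._≈_ P.0# P._*_
  series-zeroˡ p n = sum-zero (suc n) _ λ i → zeroˡ (p (n ∸ toℕ i))

  constant-* : ∀ {p c} u → p 0 ≈ c → (∀ i → p (suc i) ≈ 0#) → ∀ n → (p P.* u) n ≈ c ⊛ u n
  constant-* u p₀ pₙ n = +.trans
    (+.∙-cong (*-cong p₀ +.refl) (sum-zero n _ λ i → +.trans (*-cong (pₙ (toℕ i)) +.refl) (zeroˡ _)))
    (+.identityʳ _)

  linear-*₀ : ∀ {p c} u → p 0 ≈ c → (p P.* u) 0 ≈ c ⊛ u 0
  linear-*₀ u p₀ = +.trans (+.identityʳ _) (*-cong p₀ +.refl)

  -- Left factors such as `t`, `x t f` and `1 - t f` have degree at most one in `t`, so only two
  -- terms of the Cauchy product survive.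
  linear-*₊ : ∀ {p c d} u → p 0 ≈ c → p 1 ≈ d → (∀ i → p (2 + i) ≈ 0#) →
              ∀ n → (p P.* u) (suc n) ≈ c ⊛ u (suc n) ⊕ d ⊛ u n
  linear-*₊ u p₀ p₁ pₙ n = +.∙-cong (*-cong p₀ +.refl) (+.trans
    (+.∙-cong (*-cong p₁ +.refl) (sum-zero n _ λ i → +.trans (*-cong (pₙ (toℕ i)) +.refl) (zeroˡ _)))
    (+.identityʳ _))

  monomial-*₊ : ∀ {p d} u → p 0 ≈ 0# → p 1 ≈ d → (∀ i → p (2 + i) ≈ 0#) →
                ∀ n → (p P.* u) (suc n) ≈ d ⊛ u n
  monomial-*₊ {p} u p₀ p₁ pₙ n =
    +.trans (linear-*₊ {p} u p₀ p₁ pₙ n) (+.trans (+.∙-cong (zeroˡ _) +.refl) (+.identityˡ _))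

module ℤ⟦x⟧ = Coefficients +-*-rawRing ℤ.+-0-isMonoid (cong₂ ℤ._*_) ℤ.*-zeroˡ
module ℤ⟦x⟧⟦t⟧ = Coefficients (powerSeries +-*-rawRing)
  ℤ⟦x⟧.series-+-isMonoid ℤ⟦x⟧.series-*-cong ℤ⟦x⟧.series-zeroˡ

private
  open MonoidSum ℤ.+-0-monoid using (sum-cong-≗) renaming (sum to Σ)

  x*₀ : ∀ h → (x X.* h) 0 ≡ 0ℤ
  x*₀ h = ℤ⟦x⟧.linear-*₀ {x} h refl

  x*₊ : ∀ h n → (x X.* h) (suc n) ≡ h n
  x*₊ h n = trans (ℤ⟦x⟧.monomial-*₊ {x} h refl refl (λ _ → refl) n) (ℤ.*-identityˡ (h n))

  x*-zeroʳ : x X.* X.0# X.≈ X.0#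
  x*-zeroʳ zero    = x*₀ X.0#
  x*-zeroʳ (suc n) = x*₊ X.0# n

  x*-identityʳ : x X.* X.1# X.≈ x
  x*-identityʳ zero          = x*₀ X.1#
  x*-identityʳ (suc zero)    = x*₊ X.1# 0
  x*-identityʳ (suc (suc n)) = x*₊ X.1# (suc n)

  -- Multiplication by `x` shifts coefficients: once the vanishing term at index 0 is split off, the
  -- two Cauchy sums agree term by term.
  x*-assoc : ∀ p q → (x X.* p) X.* q X.≈ x X.* (p X.* q)
  x*-assoc p q zero    = trans (ℤ⟦x⟧.linear-*₀ {x X.* p} q (x*₀ p)) (sym (x*₀ (p X.* q)))
  x*-assoc p q (suc n) = begin
    (x X.* p) 0 ℤ.* q (suc n) ℤ.+ Σ {suc n} (λ i → (x X.* p) (suc (toℕ i)) ℤ.* q (n ∸ toℕ i))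
      ≡⟨ cong₂ ℤ._+_ (cong (ℤ._* q (suc n)) (x*₀ p))
           (sum-cong-≗ {suc n} λ i → cong (ℤ._* q (n ∸ toℕ i)) (x*₊ p (toℕ i))) ⟩
    0ℤ ℤ.* q (suc n) ℤ.+ (p X.* q) n
      ≡⟨ ℤ.+-identityˡ _ ⟩
    (p X.* q) n
      ≡⟨ x*₊ (p X.* q) n ⟨
    (x X.* (p X.* q)) (suc n) ∎
    where open ≡-Reasoning

  1*-identity : ∀ p → X.1# X.* p X.≈ p
  1*-identity p n = trans (ℤ⟦x⟧.constant-* {X.1#} p refl (λ _ → refl) n) (ℤ.*-identityˡ (p n))

  *1-identity : ∀ p → p X.* X.1# X.≈ p
  *1-identity p zero    = trans (ℤ.+-identityʳ _) (ℤ.*-identityʳ (p 0))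
  *1-identity p (suc n) = trans (cong₂ ℤ._+_ (ℤ.*-zeroʳ (p 0)) (*1-identity (p ∘ suc) n)) (ℤ.+-identityˡ _)

  -*-distrib : ∀ p q → (X.- p) X.* q X.≈ X.- (p X.* q)
  -*-distrib p q n = neg-sum {suc n} (λ i → p (toℕ i)) (λ i → q (n ∸ toℕ i))
    where
    neg-sum : ∀ {n} (φ ψ : Fin n → ℤ) → Σ (λ i → ℤ.- φ i ℤ.* ψ i) ≡ ℤ.- Σ (λ i → φ i ℤ.* ψ i)
    neg-sum {zero}  φ ψ = refl
    neg-sum {suc n} φ ψ = trans
      (cong₂ ℤ._+_ (sym (ℤ.neg-distribˡ-* (φ Fin.zero) (ψ Fin.zero))) (neg-sum (φ ∘ Fin.suc) (ψ ∘ Fin.suc)))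
      (sym (ℤ.neg-distrib-+ (φ Fin.zero ℤ.* ψ Fin.zero) _))

  -- Links a Cauchy product, an integer sum over all indices, to the sum of naturals in the
  -- recurrence, which stops where the terms become zero.
  sum-truncate : ∀ n {c} (φ : ℕ → ℤ) (h G : ℕ → ℕ) → c ≤ n →
                 (∀ {i} → i < c → φ i ≡ ℤ.+ G (h i)) → (∀ {i} → c ≤ i → φ i ≡ 0ℤ) →
                 Σ {n} (φ ∘ toℕ) ≡ ℤ.+ sum (map G (applyUpTo h c))
  sum-truncate n {zero} φ h G _ _ φ≡0 = ℤ⟦x⟧.sum-zero n (φ ∘ toℕ) λ _ → φ≡0 z≤n
  sum-truncate (suc n) {suc c} φ h G (s≤s c≤n) φ≡G φ≡0 = trans
    (cong₂ ℤ._+_ (φ≡G z<s) (sum-truncate n (φ ∘ suc) (h ∘ suc) G c≤n (φ≡G ∘ s<s) (φ≡0 ∘ s≤s)))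
    (sym (ℤ.pos-+ (G (h 0)) _))

-- The series `T 1 k` as `x` times a power of `f`

T-in : ∀ k n → suc k ≤ n → T 1 k n ≡ ℤ.+ a n k
T-in k n k<n rewrite dec-true (suc k ≤? n) k<n = refl

T-out : ∀ k n → n ≤ k → T 1 k n ≡ 0ℤ
T-out k n n≤k rewrite dec-false (suc k ≤? n) (≤⇒≯ n≤k) = refl

convolution : ℕ → ℕ → ℕ
convolution d k = sum (map (λ m → a m 1 * a (suc d ∸ m + 1) (suc k)) (applyUpTo (2 +_) (d ∸ suc k)))

T-step : ∀ k d → T 1 (2 + k) (suc d) ≡ ℤ.+ convolution d k
T-step k d with suc k <? d
... | yes k<d = trans (T-in (2 + k) (suc d) (s≤s k<d)) (cong ℤ.+_ (recurrence d k))
-- For `d ≤ suc k` the convolution is an empty sum, and `suc d` entries are too few for a gap of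
-- `2 + k`.
... | no k≮d rewrite m≤n⇒m∸n≡0 (≮⇒≥ k≮d) = T-out (2 + k) (suc d) (s≤s (≮⇒≥ k≮d))

f^-coefficient : ∀ k d → (f X.^ suc k) d ≡ T 1 (suc k) (suc d)
f^-coefficient zero zero = *1-identity f zero
f^-coefficient zero (suc d) = trans (*1-identity f (suc d)) (sym (T-in 1 (2 + d) (s≤s (s≤s z≤n))))
f^-coefficient (suc k) d = begin
  (f X.* f X.^ suc k) d
    -- The term at index 0 reduces to zero because `f 0` does; index `suc i` of `f` then corresponds
    -- to `m = 2 + i`.
    ≡⟨ ℤ.+-identityˡ _ ⟩
  Σ {d} (λ i → f (suc (toℕ i)) ℤ.* (f X.^ suc k) (d ∸ suc (toℕ i)))
    ≡⟨ sum-truncate d (λ i → f (suc i) ℤ.* (f X.^ suc k) (d ∸ suc i)) (2 +_) _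
         (m∸n≤m d (suc k)) inside outside ⟩
  ℤ.+ convolution d k
    ≡⟨ T-step k d ⟨
  T 1 (2 + k) (suc d) ∎
  where
  open ≡-Reasoning
  inside : ∀ {i} → i < d ∸ suc k → f (suc i) ℤ.* (f X.^ suc k) (d ∸ suc i) ≡
           ℤ.+ (a (2 + i) 1 * a (suc d ∸ (2 + i) + 1) (suc k))
  inside {i} i< = begin
    ℤ.+ a (2 + i) 1 ℤ.* (f X.^ suc k) (d ∸ suc i)
      ≡⟨ cong (ℤ.+ a (2 + i) 1 ℤ.*_) (trans (f^-coefficient k (d ∸ suc i)) (T-in (suc k) _ (s≤s k<))) ⟩
    ℤ.+ a (2 + i) 1 ℤ.* ℤ.+ a (suc (d ∸ suc i)) (suc k)
      ≡⟨ ℤ.pos-* (a (2 + i) 1) _ ⟨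
    ℤ.+ (a (2 + i) 1 * a (suc (d ∸ suc i)) (suc k))
      ≡⟨ cong (λ n → ℤ.+ (a (2 + i) 1 * a n (suc k))) (suc-∸+1 d i) ⟨
    ℤ.+ (a (2 + i) 1 * a (suc d ∸ (2 + i) + 1) (suc k)) ∎
    where
    k< : suc k ≤ d ∸ suc i
    k< = m+n≤o⇒m≤o∸n (suc k) (subst (_≤ d) (+-comm (suc i) (suc k))
           (m≤o∸n⇒m+n≤o (suc i) (<⇒≤ (m∸n≢0⇒n<m (m<n⇒n≢0 i<))) i<))
  -- Here `d ∸ suc i ≤ k`, which is below the lowest degree of `f ^ suc k`.
  outside : ∀ {i} → d ∸ suc k ≤ i → f (suc i) ℤ.* (f X.^ suc k) (d ∸ suc i) ≡ 0ℤ
  outside {i} ≤i = trans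
    (cong (f (suc i) ℤ.*_) (trans (f^-coefficient k (d ∸ suc i)) (T-out (suc k) _ (s≤s small))))
    (ℤ.*-zeroʳ (f (suc i)))
    where
    small : d ∸ suc i ≤ k
    small = m≤n+o⇒m∸n≤o d (suc i) (subst (d ≤_) (cong suc (+-comm k i))
              (≤-trans (m≤n+m∸n d (suc k)) (+-monoʳ-≤ (suc k) ≤i)))

T≈xf^ : ∀ k → T 1 (suc k) X.≈ x X.* f X.^ suc k
T≈xf^ k zero    = sym (x*₀ (f X.^ suc k))
T≈xf^ k (suc d) = sym (trans (x*₊ (f X.^ suc k) d) (f^-coefficient k d))

-- The geometric series in `t f`

geometric : XT.Carrier
geometric k = f X.^ k

private
  xt : XT.Carrier
  xt = XT.const x XT.* t

  xt-coefficient : ∀ k → xt k X.≈ x X.* t k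
  xt-coefficient = ℤ⟦x⟧⟦t⟧.constant-* {XT.const x} {x} t (λ _ → refl) (λ _ _ → refl)

  xt₀ : xt 0 X.≈ X.0#
  xt₀ n = trans (xt-coefficient 0 n) (x*-zeroʳ n)

  xt₁ : xt 1 X.≈ x
  xt₁ n = trans (xt-coefficient 1 n) (x*-identityʳ n)

  xt₂₊ : ∀ k → xt (2 + k) X.≈ X.0#
  xt₂₊ k n = trans (xt-coefficient (2 + k) n) (x*-zeroʳ n)

  numerator : XT.Carrier
  numerator = xt XT.* XT.const f

  numerator₀ : numerator 0 X.≈ X.0#
  numerator₀ n = trans (ℤ⟦x⟧⟦t⟧.linear-*₀ {xt} {X.0#} (XT.const f) xt₀ n) (ℤ⟦x⟧.series-zeroˡ f n)

  numerator₊ : ∀ k → numerator (suc k) X.≈ x X.* XT.const f k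
  numerator₊ = ℤ⟦x⟧⟦t⟧.monomial-*₊ {xt} {x} (XT.const f) xt₀ xt₁ xt₂₊

  numerator₂₊ : ∀ k → numerator (2 + k) X.≈ X.0#
  numerator₂₊ k n = trans (numerator₊ (suc k) n) (x*-zeroʳ n)

  tf : XT.Carrier
  tf = t XT.* XT.const f

  tf₀ : tf 0 X.≈ X.0#
  tf₀ n = trans (ℤ⟦x⟧⟦t⟧.linear-*₀ {t} {X.0#} (XT.const f) (λ _ → refl) n) (ℤ⟦x⟧.series-zeroˡ f n)

  tf₊ : ∀ k → tf (suc k) X.≈ XT.const f k
  tf₊ k n = trans (ℤ⟦x⟧⟦t⟧.monomial-*₊ {t} {X.1#} (XT.const f) (λ _ → refl) (λ _ → refl) (λ _ _ → refl) k n)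
                  (1*-identity (XT.const f k) n)

  denominator : XT.Carrier
  denominator = XT.1# XT.- tf

  denominator₀ : denominator 0 X.≈ X.1#
  denominator₀ n = trans (cong (λ z → X.1# n ℤ.- z) (tf₀ n)) (ℤ.+-identityʳ (X.1# n))

  denominator₁ : denominator 1 X.≈ X.- f
  denominator₁ n = trans (ℤ.+-identityˡ _) (cong ℤ.-_ (tf₊ 0 n))

  denominator₂₊ : ∀ k → denominator (2 + k) X.≈ X.0#
  denominator₂₊ k n = trans (ℤ.+-identityˡ _) (cong ℤ.-_ (tf₊ (suc k) n))

-- In positive degree `suc k` only `1` times `f ^ suc k` and `- f` times `f ^ k` contribute, and
-- they cancel.
denominator-geometric : denominator XT.* geometric XT.≈ XT.1#
denominator-geometric zero n =
  trans (ℤ⟦x⟧⟦t⟧.linear-*₀ {denominator} {X.1#} geometric denominator₀ n) (1*-identity X.1# n)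
denominator-geometric (suc k) n = begin
  (denominator XT.* geometric) (suc k) n
    ≡⟨ ℤ⟦x⟧⟦t⟧.linear-*₊ {denominator} {X.1#} {X.- f} geometric
         denominator₀ denominator₁ denominator₂₊ k n ⟩
  (X.1# X.* (f X.* f X.^ k)) n ℤ.+ ((X.- f) X.* f X.^ k) n
    ≡⟨ cong₂ ℤ._+_ (1*-identity (f X.* f X.^ k) n) (-*-distrib f (f X.^ k) n) ⟩
  (f X.* f X.^ k) n ℤ.- (f X.* f X.^ k) n
    ≡⟨ ℤ.+-inverseʳ ((f X.* f X.^ k) n) ⟩
  0ℤ ∎
  where open ≡-Reasoning

-- The numerator is concentrated in degree one in `t`, with coefficient `x f`, so the coefficient in
-- degree `suc k` is `(x f) f ^ k`, which is `T 1 (suc k)` after reassociation.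
g≈numerator*geometric : g 1 XT.≈ numerator XT.* geometric
g≈numerator*geometric zero n = sym (trans (ℤ⟦x⟧⟦t⟧.linear-*₀ {numerator} {X.0#} geometric numerator₀ n)
                                          (ℤ⟦x⟧.series-zeroˡ X.1# n))
g≈numerator*geometric (suc k) n = begin
  T 1 (suc k) n                     ≡⟨ T≈xf^ k n ⟩
  (x X.* (f X.* f X.^ k)) n         ≡⟨ x*-assoc f (f X.^ k) n ⟨
  ((x X.* f) X.* f X.^ k) n
    ≡⟨ ℤ⟦x⟧⟦t⟧.monomial-*₊ {numerator} {x X.* f} geometric
         numerator₀ (numerator₊ 0) numerator₂₊ k n ⟨
  (numerator XT.* geometric) (suc k) n ∎
  where open ≡-Reasoning

theorem2p6 : (∀ (n k : ℕ) → 3 ≤ n → 2 ≤ k → k ≤ n ∸ 1 →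
    a n k ≡ ∑[ m ∈ 2 ⋯ n ∸ k + 1 ] (a m 1 * a (n ∸ m + 1) (k ∸ 1)))
    × (∀ (k : ℕ) → 1 ≤ k → T 1 k X.≈ x X.* f X.^ k)
    × (g 1 XT.≈ XT.const x XT.* t XT.* XT.const f / (XT.1# XT.- t XT.* XT.const f))
theorem2p6 =
  recurrence′ , (λ { (suc k) _ → T≈xf^ k }) , geometric , denominator-geometric , g≈numerator*geometric
  where
  recurrence′ : ∀ n k → 3 ≤ n → 2 ≤ k → k ≤ n ∸ 1 →
                a n k ≡ ∑[ m ∈ 2 ⋯ n ∸ k + 1 ] (a m 1 * a (n ∸ m + 1) (k ∸ 1))
  recurrence′ (suc d) (suc zero) _ (s≤s ()) _
  recurrence′ (suc d) (suc (suc k)) _ _ _ = trans (recurrence d k)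
    -- The range from 2 to `n ∸ k + 1` has `suc (n ∸ k + 1) ∸ 2` terms, which in the shifted
    -- variables reduces to `d ∸ suc k + 1 ∸ 1`.
    (cong (λ c → sum (map (λ m → a m 1 * a (suc d ∸ m + 1) (suc k)) (applyUpTo (2 +_) c)))
          (sym (m+n∸n≡m (d ∸ suc k) 1)))
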